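{- Let $n\ge 1$. Every $2$-coloring of the edges of the ordered complete graph on $[3n-1]$ contains a monochromatic non-separated matching with $n$ edges.
   Context: The ordered complete graph on $[m]=\{1,\dots,m\}$ is the complete graph with vertex set $[m]$, taken with its natural ordering; edges are written $(i,j)$ with $i<j$. A $2$-coloring assigns one of two colors to each edge. Two edges are independent if they share no vertex; independent edges $(a,b)$ and $(c,d)$ are separated if $a<b<c<d$ or $c<d<a<b$. A matching is a set of pairwise independent edges; it is non-separated if no two of its edges are separated, and monochromatic if all its edges have the same color. -}

module Defs where

open import Data.Nat using (ℕ)
open import Data.Fin using (Fin; _<_)
open import Data.List using (List)
open import Data.List.Relation.Unary.All using (All)
open import Data.List.Relation.Unary.AllPairs using (AllPairs)
open import Data.Product using (∃-syntax; _×_)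
open import Data.Sum using (_⊎_)
open import Relation.Nullary using (¬_)
open import Relation.Binary.PropositionalEquality using (_≡_)

-- The vertex set {1,…,m} is represented by Fin m: only the order matters, so
-- labels are shifted to start at 0.  Since _<_ is proof-irrelevant, an edge is
-- determined by its endpoints.
record Edge (m : ℕ) : Set where
  constructor edge
  field
    left       : Fin m
    right      : Fin m
    left<right : left < right

open Edge public

2-Coloring : ℕ → Set
2-Coloring m = Edge m → Fin 2

module _ {m : ℕ} where

  Incident : Fin m → Edge m → Set
  Incident v e = v ≡ left e ⊎ v ≡ right e

  Independent : Edge m → Edge m → Set
  Independent e f = ∀ v → ¬ (Incident v e × Incident v f)

  -- a < b < c < d or c < d < a < b; the inequalities a < b and c < d are part
  -- of the edges (a , b) and (c , d).
  Separated : Edge m → Edge m → Set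
  Separated e f = right e < left f ⊎ right f < left e

  -- A set of edges is given by a list.  No edge is independent of itself, so a
  -- matching has no repeated entries and its length is its number of edges.
  IsMatching : List (Edge m) → Set
  IsMatching = AllPairs Independent

  NonSeparated : List (Edge m) → Set
  NonSeparated = AllPairs (λ e f → ¬ Separated e f)

  Monochromatic : 2-Coloring m → List (Edge m) → Set
  Monochromatic χ M = ∃[ c ] All (λ e → χ e ≡ c) M

{-# OPTIONS --safe #-}

-- Pairwise non-separated edges are exactly edges that all cross a common cut
-- {i < k} | {i ≥ k}, so one looks for a monochromatic matching in the complete
-- bipartite graph of some cut.  If the cut k has none, König's theorem gives for
-- each colour c a vertex cover A c ∪ B c with fewer than n vertices, A c being
-- used to the left and B c to the right of the cut.  As every edge across the cut
-- has a colour, A 0 ∪ A 1 contains the left side or B 0 ∪ B 1 the right side.  The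
-- former holds at k = 0 and fails at k = 3n - 1, hence for some k the left side is
-- contained in A 0 ∪ A 1 while the cut k + 1, with covers A′ c ∪ B′ c, has its
-- right side contained in B′ 0 ∪ B′ 1.  By counting, some j > k (zero-based) lies
-- outside B 0, B 1 and B′ 0 ∩ B′ 1, say j ∈ B′ c and j ∉ B′ d.  The colours of the
-- edges from j to the left show that A c ∪ A′ d contains the left side of the
-- cut k, which is too large for that.

module Submission where

open import Data.Empty using () renaming (⊥ to False)
open import Data.Nat using (ℕ; zero; suc; _+_; _*_; _∸_; _≤_; _<_; z≤n; s≤s; _≤?_; _<?_)
open import Data.Nat.Properties
open import Data.Nat.Tactic.RingSolver using (solve-∀)
open import Data.Fin using (Fin; zero; suc; toℕ)
import Data.Fin.Properties as Fin
open import Data.Fin.Subset using (Subset; inside; outside; ⊥; ⁅_⁆; _∪_; _∩_; ∣_∣) renaming (_∈_ to _∈ˢ_; _∉_ to _∉ˢ_)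
open import Data.Fin.Subset.Properties using (_∈?_; drop-there; ∣p∣≤∣x∷p∣; ∣⊥∣≡0; ∣⁅x⁆∣≡1; x∈⁅x⁆; x∈p∪q⁺; x∈p∪q⁻; x∈p∩q⁺)
open import Data.List using (List; []; _∷_; length; take; filter; concatMap; cartesianProduct; allFin)
open import Data.List.Properties using (length-take)
open import Data.List.Membership.Propositional using (_∈_; find; lose)
open import Data.List.Membership.Propositional.Properties using (∈-∃++; ∈-concatMap⁺; ∈-cartesianProduct⁺; ∈-allFin; ∈-filter⁺; ∈-filter⁻)
open import Data.List.Relation.Binary.Permutation.Propositional using (_↭_; ↭-refl; ↭-trans; ↭-sym; prep; swap)
open import Data.List.Relation.Binary.Permutation.Propositional.Properties using (∈-resp-↭; ↭-length; shift)
open import Data.List.Relation.Unary.All as All using (All; []; _∷_)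
import Data.List.Relation.Unary.All.Properties as All
open import Data.List.Relation.Unary.AllPairs using (AllPairs; []; _∷_)
import Data.List.Relation.Unary.AllPairs.Properties as AllPairs
open import Data.List.Relation.Unary.Any using (here; there; any?)
open import Data.Product using (∃-syntax; _×_; _,_; proj₁; proj₂)
open import Data.Sum as Sum using (_⊎_; inj₁; inj₂)
open import Data.Vec using ([]; _∷_; here; there)
open import Function using (id; _∘_)
open import Relation.Binary.PropositionalEquality using (_≡_; _≢_; refl; sym; trans; cong; cong₂; subst)
open import Relation.Nullary using (¬_; Dec; yes; no; contradiction; ¬?; _×-dec_; _⊎-dec_; decidable-stable)
open import Defs

private
  variable
    p q : ℕ

-- Systems of linear inequalities are refuted by adding them up with suitable
-- multiplicities; z is the surplus.  Abstract because matching on the equation makes Agda evaluate the ring solver's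
-- proofs on open terms.
abstract
  ≤⇒≢suc+ : ∀ {x y z} → x ≤ y → x ≢ suc (y + z)
  ≤⇒≢suc+ {y = y} {z} x≤y refl = m+1+n≰m y (subst (_≤ y) (sym (+-suc y z)) x≤y)

-- Cardinalities of subsets, and auxiliary facts on lists.

∣p∪q∣+∣p∩q∣ : (A B : Subset p) → ∣ A ∪ B ∣ + ∣ A ∩ B ∣ ≡ ∣ A ∣ + ∣ B ∣
∣p∪q∣+∣p∩q∣ []            []            = refl
∣p∪q∣+∣p∩q∣ (inside  ∷ A) (inside  ∷ B) = cong suc (trans (+-suc _ _) (trans (cong suc (∣p∪q∣+∣p∩q∣ A B)) (sym (+-suc _ _))))
∣p∪q∣+∣p∩q∣ (inside  ∷ A) (outside ∷ B) = cong suc (∣p∪q∣+∣p∩q∣ A B)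
∣p∪q∣+∣p∩q∣ (outside ∷ A) (inside  ∷ B) = trans (cong suc (∣p∪q∣+∣p∩q∣ A B)) (sym (+-suc _ _))
∣p∪q∣+∣p∩q∣ (outside ∷ A) (outside ∷ B) = ∣p∪q∣+∣p∩q∣ A B

∣p∪q∣≤∣p∣+∣q∣ : (A B : Subset p) → ∣ A ∪ B ∣ ≤ ∣ A ∣ + ∣ B ∣
∣p∪q∣≤∣p∣+∣q∣ A B = ≤-trans (m≤m+n _ _) (≤-reflexive (∣p∪q∣+∣p∩q∣ A B))

Initial⊆ : ℕ → Subset p → Set
Initial⊆ k A = ∀ i → toℕ i < k → i ∈ˢ A

Final⊆ : ℕ → Subset p → Set
Final⊆ k A = ∀ i → k ≤ toℕ i → i ∈ˢ A

Initial⊆⇒k≤∣A∣ : ∀ {k} (A : Subset p) → k ≤ p → Initial⊆ k A → k ≤ ∣ A ∣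
Initial⊆⇒k≤∣A∣ A       z≤n       _  = z≤n
Initial⊆⇒k≤∣A∣ (s ∷ A) (s≤s k≤p) ⊆A with ⊆A zero (s≤s z≤n)
... | here = s≤s (Initial⊆⇒k≤∣A∣ A k≤p λ i i<k → drop-there (⊆A (suc i) (s≤s i<k)))

Final⊆⇒p≤k+∣A∣ : ∀ k (A : Subset p) → Final⊆ k A → p ≤ k + ∣ A ∣
Final⊆⇒p≤k+∣A∣ k       []      _  = z≤n
Final⊆⇒p≤k+∣A∣ zero    (s ∷ A) ⊆A with ⊆A zero z≤n
... | here = s≤s (Final⊆⇒p≤k+∣A∣ zero A λ i _ → drop-there (⊆A (suc i) z≤n))
Final⊆⇒p≤k+∣A∣ (suc k) (s ∷ A) ⊆A =
  s≤s (≤-trans (Final⊆⇒p≤k+∣A∣ k A λ i k≤i → drop-there (⊆A (suc i) (s≤s k≤i))) (+-monoʳ-≤ k (∣p∣≤∣x∷p∣ s A)))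

AllPairs-refine : ∀ {X : Set} {P : X → Set} {R S : X → X → Set} →
  (∀ x y → P x → P y → R x y → S x y) → ∀ {xs} → All P xs → AllPairs R xs → AllPairs S xs
AllPairs-refine f []         []         = []
AllPairs-refine f (px ∷ pxs) (rx ∷ rxs) = All.zipWith (λ (py , r) → f _ _ px py r) (pxs , rx) ∷ AllPairs-refine f pxs rxs

∈⇒↭∷ : ∀ {X : Set} {x : X} {xs} → x ∈ xs → ∃[ ys ] xs ↭ x ∷ ys
∈⇒↭∷ {x = x} x∈xs with ys , zs , refl ← ∈-∃++ x∈xs = _ , shift x ys zs

-- König's theorem

-- The bipartite graph is a list of edges with endpoint maps into two separate vertex sets. At a cut
-- both sets are `Fin m`, one copy for each side.
CoverBelow : ∀ {X : Set} → (X → Fin p) → (X → Fin q) → ℕ → List X → Set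
CoverBelow l r t E =
  ∃[ A ] ∃[ B ] (∣ A ∣ + ∣ B ∣ < t × (∀ {e} → e ∈ E → l e ∈ˢ A ⊎ r e ∈ˢ B))

CoverBelow-flip : ∀ {X : Set} {l : X → Fin p} {r : X → Fin q} {t E} →
  CoverBelow l r t E → CoverBelow r l t E
CoverBelow-flip {t = t} (A , B , small , covers) =
  B , A , subst (_< t) (+-comm ∣ A ∣ ∣ B ∣) small , Sum.swap ∘ covers

-- Submodularity: the meet (A₁ ∩ A₂ , B₁ ∪ B₂) of two covers and their join
-- (A₁ ∪ A₂ , B₁ ∩ B₂), enlarged by the common endpoint of e and f, are both covers
-- of the whole graph, and at least one of them is small.
CoverBelow-merge : ∀ {X : Set} (l : X → Fin p) (r : X → Fin q) {t E e f} → l e ≡ l f →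
  CoverBelow l r t (e ∷ E) → CoverBelow l r t (f ∷ E) → CoverBelow l r t (e ∷ f ∷ E)
CoverBelow-merge l r {t} {E} {e} {f} le≡lf (A₁ , B₁ , small₁ , covers₁) (A₂ , B₂ , small₂ , covers₂)
  with l e ∈? A₁ | l e ∈? A₂
-- If one of the covers contains the common endpoint, it covers both `e` and `f` already.
... | yes x∈A₁ | _ = A₁ , B₁ , small₁ , λ where
  (here refl)          → inj₁ x∈A₁
  (there (here refl))  → inj₁ (subst (_∈ˢ A₁) le≡lf x∈A₁)
  (there (there g∈E))  → covers₁ (there g∈E)
... | no _ | yes x∈A₂ = A₂ , B₂ , small₂ , λ where
  (here refl)          → inj₁ x∈A₂
  (there (here refl))  → inj₁ (subst (_∈ˢ A₂) le≡lf x∈A₂)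
  (there (there g∈E))  → covers₂ (there g∈E)
... | no x∉A₁ | no x∉A₂ with ∣ A₁ ∩ A₂ ∣ + ∣ B₁ ∪ B₂ ∣ <? t
...   | yes small = A₁ ∩ A₂ , B₁ ∪ B₂ , small , covers
  where
  meet : ∀ {g} → l g ∈ˢ A₁ ⊎ r g ∈ˢ B₁ → l g ∈ˢ A₂ ⊎ r g ∈ˢ B₂ → l g ∈ˢ A₁ ∩ A₂ ⊎ r g ∈ˢ B₁ ∪ B₂
  meet (inj₁ a₁) (inj₁ a₂) = inj₁ (x∈p∩q⁺ (a₁ , a₂))
  meet (inj₂ b₁) _         = inj₂ (x∈p∪q⁺ (inj₁ b₁))
  meet _         (inj₂ b₂) = inj₂ (x∈p∪q⁺ (inj₂ b₂))

  covers : ∀ {g} → g ∈ e ∷ f ∷ E → l g ∈ˢ A₁ ∩ A₂ ⊎ r g ∈ˢ B₁ ∪ B₂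
  covers (here refl) with covers₁ (here refl)
  ... | inj₁ x∈A₁ = contradiction x∈A₁ x∉A₁
  ... | inj₂ y∈B₁ = inj₂ (x∈p∪q⁺ (inj₁ y∈B₁))
  covers (there (here refl)) with covers₂ (here refl)
  ... | inj₁ x∈A₂ = contradiction (subst (_∈ˢ A₂) (sym le≡lf) x∈A₂) x∉A₂
  ... | inj₂ z∈B₂ = inj₂ (x∈p∪q⁺ (inj₂ z∈B₂))
  covers (there (there g∈E)) = meet (covers₁ (there g∈E)) (covers₂ (there g∈E))
...   | no big = ⁅ l e ⁆ ∪ (A₁ ∪ A₂) , B₁ ∩ B₂ , small , covers
  where
  join : ∀ {g} → l g ∈ˢ A₁ ⊎ r g ∈ˢ B₁ → l g ∈ˢ A₂ ⊎ r g ∈ˢ B₂ → l g ∈ˢ A₁ ∪ A₂ ⊎ r g ∈ˢ B₁ ∩ B₂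
  join (inj₁ a₁) _         = inj₁ (x∈p∪q⁺ (inj₁ a₁))
  join _         (inj₁ a₂) = inj₁ (x∈p∪q⁺ (inj₂ a₂))
  join (inj₂ b₁) (inj₂ b₂) = inj₂ (x∈p∩q⁺ (b₁ , b₂))

  covers : ∀ {g} → g ∈ e ∷ f ∷ E → l g ∈ˢ ⁅ l e ⁆ ∪ (A₁ ∪ A₂) ⊎ r g ∈ˢ B₁ ∩ B₂
  covers (here refl)          = inj₁ (x∈p∪q⁺ (inj₁ (x∈⁅x⁆ (l e))))
  covers (there (here refl))  = inj₁ (x∈p∪q⁺ (inj₁ (subst (_∈ˢ ⁅ l e ⁆) le≡lf (x∈⁅x⁆ (l e)))))
  covers (there (there g∈E))  =
    Sum.map₁ (x∈p∪q⁺ ∘ inj₂) (join (covers₁ (there g∈E)) (covers₂ (there g∈E)))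

  size : ∣ ⁅ l e ⁆ ∪ (A₁ ∪ A₂) ∣ ≤ 1 + ∣ A₁ ∪ A₂ ∣
  size = ≤-trans (∣p∪q∣≤∣p∣+∣q∣ ⁅ l e ⁆ (A₁ ∪ A₂)) (≤-reflexive (cong (_+ ∣ A₁ ∪ A₂ ∣) (∣⁅x⁆∣≡1 (l e))))

  small : ∣ ⁅ l e ⁆ ∪ (A₁ ∪ A₂) ∣ + ∣ B₁ ∩ B₂ ∣ < t
  -- Meet and join together have the size of the two given covers, at most `2t - 2`. As the meet has
  -- size at least `t`, the join has at most `t - 2`, which leaves room for the extra vertex `l e`.
  small = +-cancelʳ-≤ t _ _ (begin
    suc (∣ ⁅ l e ⁆ ∪ (A₁ ∪ A₂) ∣ + ∣ B₁ ∩ B₂ ∣) + t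
      ≤⟨ +-mono-≤ (s≤s (+-monoˡ-≤ ∣ B₁ ∩ B₂ ∣ size)) (≮⇒≥ big) ⟩
    suc (1 + ∣ A₁ ∪ A₂ ∣ + ∣ B₁ ∩ B₂ ∣) + (∣ A₁ ∩ A₂ ∣ + ∣ B₁ ∪ B₂ ∣)
      ≡⟨ regroup (∣ A₁ ∪ A₂ ∣) (∣ A₁ ∩ A₂ ∣) (∣ B₁ ∪ B₂ ∣) (∣ B₁ ∩ B₂ ∣) ⟩
    2 + ((∣ A₁ ∪ A₂ ∣ + ∣ A₁ ∩ A₂ ∣) + (∣ B₁ ∪ B₂ ∣ + ∣ B₁ ∩ B₂ ∣))
      ≡⟨ cong (2 +_) (cong₂ _+_ (∣p∪q∣+∣p∩q∣ A₁ A₂) (∣p∪q∣+∣p∩q∣ B₁ B₂)) ⟩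
    2 + ((∣ A₁ ∣ + ∣ A₂ ∣) + (∣ B₁ ∣ + ∣ B₂ ∣))
      ≡⟨ regroup′ (∣ A₁ ∣) (∣ A₂ ∣) (∣ B₁ ∣) (∣ B₂ ∣) ⟩
    suc (∣ A₁ ∣ + ∣ B₁ ∣) + suc (∣ A₂ ∣ + ∣ B₂ ∣)
      ≤⟨ +-mono-≤ small₁ small₂ ⟩
    t + t ∎)
    where
    open ≤-Reasoning
    regroup : ∀ u v w z → (1 + (1 + u + z)) + (v + w) ≡ 2 + ((u + v) + (w + z))
    regroup = solve-∀
    regroup′ : ∀ u v w z → 2 + ((u + v) + (w + z)) ≡ (1 + (u + w)) + (1 + (v + z))
    regroup′ = solve-∀

module König {X : Set} (l : X → Fin p) (r : X → Fin q) where

  Disjoint : X → X → Set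
  Disjoint e f = ¬ (l e ≡ l f ⊎ r e ≡ r f)

  MatchingIn : ℕ → List X → Set
  MatchingIn t E = ∃[ M ] (AllPairs Disjoint M × All (_∈ E) M × length M ≡ t)

  disjoint? : ∀ E → AllPairs Disjoint E ⊎
    ∃[ e ] ∃[ f ] ∃[ E′ ] ((l e ≡ l f ⊎ r e ≡ r f) × E ↭ e ∷ f ∷ E′)
  disjoint? []      = inj₁ []
  disjoint? (e ∷ E) with any? (λ f → l e Fin.≟ l f ⊎-dec r e Fin.≟ r f) E | disjoint? E
  ... | _     | inj₂ (f , g , E′ , meet , E↭) =
    inj₂ (f , g , e ∷ E′ , meet , ↭-trans (prep e E↭) (↭-trans (swap e f ↭-refl) (prep f (swap e g ↭-refl))))
  ... | no ¬meets | inj₁ disj = inj₁ (All.¬Any⇒All¬ E ¬meets ∷ disj)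
  ... | yes meets | inj₁ _ with f , f∈E , meet ← find meets with E′ , E↭ ← ∈⇒↭∷ f∈E =
    inj₂ (e , f , E′ , meet , prep e E↭)

  lefts : ∀ E → ∃[ A ] (∣ A ∣ ≤ length E × (∀ {e} → e ∈ E → l e ∈ˢ A))
  lefts []      = ⊥ , ≤-reflexive (∣⊥∣≡0 p) , λ ()
  lefts (e ∷ E) with A , size , l∈A ← lefts E =
    ⁅ l e ⁆ ∪ A ,
    ≤-trans (∣p∪q∣≤∣p∣+∣q∣ ⁅ l e ⁆ A) (+-mono-≤ (≤-reflexive (∣⁅x⁆∣≡1 (l e))) size) ,
    λ { (here refl) → x∈p∪q⁺ (inj₁ (x∈⁅x⁆ (l e))) ; (there f∈E) → x∈p∪q⁺ (inj₂ (l∈A f∈E)) }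

  MatchingIn-mono : ∀ {t E F} → (∀ {e} → e ∈ E → e ∈ F) → MatchingIn t E → MatchingIn t F
  MatchingIn-mono E⊆F (M , disj , M⊆E , len) = M , disj , All.map E⊆F M⊆E , len

  CoverBelow-anti : ∀ {t E F} → (∀ {e} → e ∈ E → e ∈ F) → CoverBelow l r t F → CoverBelow l r t E
  CoverBelow-anti E⊆F (A , B , small , covers) = A , B , small , covers ∘ E⊆F

  -- Two edges with a common endpoint are removed in turn, and the two covers
  -- obtained recursively are merged.
  könig-fuel : ∀ s t E → length E ≤ s → MatchingIn t E ⊎ CoverBelow l r t E
  könig-fuel s t E ∣E∣≤s with disjoint? E
  ... | inj₁ disj with t ≤? length E
  ...   | yes t≤∣E∣ = inj₁ (take t E , AllPairs.take⁺ t disj , All.take⁺ t (All.tabulate id) ,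
                            trans (length-take t E) (m≤n⇒m⊓n≡m t≤∣E∣))
  -- Fewer than `t` edges remain, so their left endpoints alone form a small cover.
  ...   | no  t≰∣E∣ with A , size , l∈A ← lefts E = inj₂ (A , ⊥ ,
      subst (_< t) (trans (sym (+-identityʳ ∣ A ∣)) (cong (∣ A ∣ +_) (sym (∣⊥∣≡0 q)))) (≤-<-trans size (≰⇒> t≰∣E∣)) ,
      inj₁ ∘ l∈A)
  könig-fuel s t E ∣E∣≤s | inj₂ (e , f , E′ , meet , E↭)
    -- `E` contains both `e` and `f`, so `s` is positive, and dropping either edge leaves a list of
    -- length at most `s′`.
    with s | ≤-trans (≤-reflexive (sym (↭-length E↭))) ∣E∣≤s
  ... | suc s′ | s≤s len with könig-fuel s′ t (e ∷ E′) len | könig-fuel s′ t (f ∷ E′) len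
  ...   | inj₁ M  | _       = inj₁ (MatchingIn-mono (∈-resp-↭ (↭-sym E↭) ∘ λ { (here g≡e) → here g≡e ; (there g∈E′) → there (there g∈E′) }) M)
  ...   | inj₂ _  | inj₁ M  = inj₁ (MatchingIn-mono (∈-resp-↭ (↭-sym E↭) ∘ there) M)
  ...   | inj₂ C₁ | inj₂ C₂ = inj₂ (CoverBelow-anti (∈-resp-↭ E↭) (merged meet))
    where
    merged : l e ≡ l f ⊎ r e ≡ r f → CoverBelow l r t (e ∷ f ∷ E′)
    merged (inj₁ le≡lf) = CoverBelow-merge l r le≡lf C₁ C₂
    merged (inj₂ re≡rf) = CoverBelow-flip (CoverBelow-merge r l re≡rf (CoverBelow-flip C₁) (CoverBelow-flip C₂))

  könig : ∀ t E → MatchingIn t E ⊎ CoverBelow l r t E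
  könig t E = könig-fuel (length E) t E ≤-refl

-- Cuts of the ordered complete graph

allEdges : ∀ m → List (Edge m)
allEdges m = concatMap toEdges (cartesianProduct (allFin m) (allFin m))
  module AllEdges where
  toEdges : Fin m × Fin m → List (Edge m)
  toEdges (i , j) with toℕ i <? toℕ j
  ... | yes i<j = edge i j i<j ∷ []
  ... | no  _   = []

∈-allEdges : ∀ {m} (e : Edge m) → e ∈ allEdges m
∈-allEdges {m} e@(edge i j i<j) =
  ∈-concatMap⁺ toEdges (lose (∈-cartesianProduct⁺ (∈-allFin i) (∈-allFin j)) e∈)
  where
  open AllEdges m
  e∈ : e ∈ toEdges (i , j)
  e∈ with toℕ i <? toℕ j
  ... | yes i<j′ = here (cong (edge i j) (<-irrelevant i<j i<j′))
  ... | no  i≮j  = contradiction i<j i≮j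

-- The bound `m ≥ 3n - 1` is put without subtraction so that it can be added to other inequalities.
module Cuts {m : ℕ} (n : ℕ) (3n≤1+m : 3 * n ≤ suc m) (χ : 2-Coloring m) where

  MonochromaticMatching : Set
  MonochromaticMatching = ∃[ M ] (IsMatching M × NonSeparated M × Monochromatic χ M × length M ≡ n)

  Crosses : ℕ → Edge m → Set
  Crosses k e = toℕ (left e) < k × k ≤ toℕ (right e)

  crossing? : ∀ k c e → Dec (Crosses k e × χ e ≡ c)
  crossing? k c e = (toℕ (left e) <? k ×-dec k ≤? toℕ (right e)) ×-dec χ e Fin.≟ c

  crossing : ℕ → Fin 2 → List (Edge m)
  crossing k c = filter (crossing? k c) (allEdges m)

  open König (left {m}) right

  crossing-matching : ∀ k c → MatchingIn n (crossing k c) → MonochromaticMatching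
  crossing-matching k c (M , disj , M⊆ , len) =
    M , AllPairs-refine independent crosses disj , AllPairs-refine nonSeparated crosses disj ,
    (c , All.map proj₂ props) , len
    where
    props : All (λ e → Crosses k e × χ e ≡ c) M
    props = All.map (proj₂ ∘ ∈-filter⁻ (crossing? k c) {xs = allEdges m}) M⊆

    crosses : All (Crosses k) M
    crosses = All.map proj₁ props

    -- The cut separates every left endpoint from every right endpoint. This excludes separated
    -- edges and a vertex that is left in one edge and right in the other; `Disjoint` excludes the
    -- other coincidences.
    left<right′ : ∀ e f → Crosses k e → Crosses k f → toℕ (left e) < toℕ (right f)
    left<right′ _ _ (l<k , _) (_ , k≤r) = <-≤-trans l<k k≤r

    independent : ∀ e f → Crosses k e → Crosses k f → Disjoint e f → Independent e f
    independent e f x y d v (inj₁ refl , inj₁ eq)   = d (inj₁ eq)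
    independent e f x y d v (inj₁ refl , inj₂ refl) = <-irrefl refl (left<right′ e f x y)
    independent e f x y d v (inj₂ refl , inj₁ refl) = <-irrefl refl (left<right′ f e y x)
    independent e f x y d v (inj₂ refl , inj₂ eq)   = d (inj₂ eq)

    nonSeparated : ∀ e f → Crosses k e → Crosses k f → Disjoint e f → ¬ Separated e f
    nonSeparated e f x y _ (inj₁ re<lf) = <-asym re<lf (left<right′ f e y x)
    nonSeparated e f x y _ (inj₂ rf<le) = <-asym rf<le (left<right′ e f x y)

  -- Small covers of both colour classes at one cut.

  record Covers (k : ℕ) : Set where
    field
      A B    : Fin 2 → Subset m
      small  : ∀ c → ∣ A c ∣ + ∣ B c ∣ < n
      covers : ∀ e → Crosses k e → left e ∈ˢ A (χ e) ⊎ right e ∈ˢ B (χ e)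

    ∪A ∪B : Subset m
    ∪A = A zero ∪ A (suc zero)
    ∪B = B zero ∪ B (suc zero)

    -- If some `i` left of the cut is outside `∪A`, every edge from `i` across the cut is covered at
    -- its right end, whatever its colour.
    initial-or-final : Initial⊆ k ∪A ⊎ Final⊆ k ∪B
    initial-or-final with Fin.any? (λ i → toℕ i <? k ×-dec ¬? (i ∈? ∪A))
    ... | no ¬out = inj₁ λ i i<k → decidable-stable (i ∈? ∪A) λ i∉ → ¬out (i , i<k , i∉)
    ... | yes (i , i<k , i∉) = inj₂ λ j k≤j → pick (χ (edge i j (<-≤-trans i<k k≤j))) (covers _ (i<k , k≤j))
      where
      pick : ∀ {j} c → i ∈ˢ A c ⊎ j ∈ˢ B c → j ∈ˢ ∪B
      pick zero       (inj₁ i∈) = contradiction (x∈p∪q⁺ (inj₁ i∈)) i∉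
      pick (suc zero) (inj₁ i∈) = contradiction (x∈p∪q⁺ (inj₂ i∈)) i∉
      pick zero       (inj₂ j∈) = x∈p∪q⁺ (inj₁ j∈)
      pick (suc zero) (inj₂ j∈) = x∈p∪q⁺ (inj₂ j∈)

  covers-or-matching : ∀ k → MonochromaticMatching ⊎ Covers k
  covers-or-matching k with könig n (crossing k zero) | könig n (crossing k (suc zero))
  ... | inj₁ M | _      = inj₁ (crossing-matching k zero M)
  ... | inj₂ _ | inj₁ M = inj₁ (crossing-matching k (suc zero) M)
  ... | inj₂ (A₀ , B₀ , small₀ , covers₀) | inj₂ (A₁ , B₁ , small₁ , covers₁) = inj₂ record
    { A = A ; B = B
    ; small = λ { zero → small₀ ; (suc zero) → small₁ }
    ; covers = λ e x → split e (χ e) (∈-filter⁺ (crossing? k (χ e)) (∈-allEdges e) (x , refl))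
    }
    where
    A B : Fin 2 → Subset m
    A zero = A₀
    A (suc zero) = A₁
    B zero = B₀
    B (suc zero) = B₁
    split : ∀ e c → e ∈ crossing k c → left e ∈ˢ A c ⊎ right e ∈ˢ B c
    split e zero       = covers₀
    split e (suc zero) = covers₁

  -- Two consecutive cuts.

  module Jump {k} (k<m : k < m) (C : Covers k) (C′ : Covers (suc k)) where

    open Covers C
    open Covers C′ renaming (A to A′; B to B′; small to small′; covers to covers′; ∪B to ∪B′)
      hiding (∪A; initial-or-final)

    ∩B′ : Subset m
    ∩B′ = B′ zero ∩ B′ (suc zero)

    module _ (initial : Initial⊆ k ∪A) (final : Final⊆ (suc k) ∪B′) where

      k≤ : k ≤ ∣ A zero ∣ + ∣ A (suc zero) ∣
      k≤ = ≤-trans (Initial⊆⇒k≤∣A∣ ∪A (<⇒≤ k<m) initial) (∣p∪q∣≤∣p∣+∣q∣ (A zero) (A (suc zero)))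

      -- Inclusion-exclusion. The term `∣ ∩B′ ∣` is kept because it cancels against the one in the
      -- bound for `∪B ∪ ∩B′`.
      m+∣∩B′∣≤ : m + ∣ ∩B′ ∣ ≤ suc k + (∣ B′ zero ∣ + ∣ B′ (suc zero) ∣)
      m+∣∩B′∣≤ = begin
        m + ∣ ∩B′ ∣                    ≤⟨ +-monoˡ-≤ ∣ ∩B′ ∣ (Final⊆⇒p≤k+∣A∣ (suc k) ∪B′ final) ⟩
        suc k + ∣ ∪B′ ∣ + ∣ ∩B′ ∣      ≡⟨ +-assoc (suc k) ∣ ∪B′ ∣ ∣ ∩B′ ∣ ⟩
        suc k + (∣ ∪B′ ∣ + ∣ ∩B′ ∣)    ≡⟨ cong (suc k +_) (∣p∪q∣+∣p∩q∣ (B′ zero) (B′ (suc zero))) ⟩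
        suc k + (∣ B′ zero ∣ + ∣ B′ (suc zero) ∣)  ∎
        where open ≤-Reasoning

      ∪B∪∩B′-not-final : ¬ Final⊆ (suc k) (∪B ∪ ∩B′)
      -- Write `a`, `b`, `b′` for the total sizes of the `A c`, `B c`, `B′ c`. The two bounds on `m`
      -- add up to `2m ≤ 2(k + 1) + b + b′`. With `k ≤ a`, this is at most `2 + 2(a + b) + b′ ≤ 2 +
      -- 2(2n - 2) + (2n - 2) = 6n - 4`, whereas `2m ≥ 6n - 2`.
      ∪B∪∩B′-not-final fin = ≤⇒≢suc+
        (+-mono-≤ (+-mono-≤ (+-mono-≤ (*-monoʳ-≤ 2 (+-mono-≤ (small zero) (small (suc zero))))
            (+-mono-≤ (small′ zero) (small′ (suc zero)))) (*-monoʳ-≤ 2 k≤))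
          (+-mono-≤ m+∣∩B′∣≤ (+-mono-≤ m≤ (*-monoʳ-≤ 2 3n≤1+m))))
        (identity k m n (∣ A zero ∣) (∣ A (suc zero) ∣) (∣ B zero ∣) (∣ B (suc zero) ∣)
          (∣ A′ zero ∣) (∣ A′ (suc zero) ∣) (∣ B′ zero ∣) (∣ B′ (suc zero) ∣) (∣ ∩B′ ∣))
        where
        m≤ : m ≤ suc k + (∣ B zero ∣ + ∣ B (suc zero) ∣ + ∣ ∩B′ ∣)
        m≤ = ≤-trans (Final⊆⇒p≤k+∣A∣ (suc k) (∪B ∪ ∩B′) fin)
          (+-monoʳ-≤ (suc k) (≤-trans (∣p∪q∣≤∣p∣+∣q∣ ∪B ∩B′) (+-monoˡ-≤ ∣ ∩B′ ∣ (∣p∪q∣≤∣p∣+∣q∣ (B zero) (B (suc zero))))))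
        identity : ∀ k m n a₀ a₁ b₀ b₁ a₀′ a₁′ b₀′ b₁′ t →
          2 * ((1 + (a₀ + b₀)) + (1 + (a₁ + b₁))) + ((1 + (a₀′ + b₀′)) + (1 + (a₁′ + b₁′))) + 2 * k
            + ((m + t) + (m + 2 * (3 * n)))
          ≡ 1 + (2 * (n + n) + (n + n) + 2 * (a₀ + a₁)
            + (((1 + k) + (b₀′ + b₁′)) + ((1 + k) + (b₀ + b₁ + t) + 2 * (1 + m))) + (1 + b₀ + b₁ + a₀′ + a₁′))
        identity = solve-∀

      -- An edge from `j` to the left side is covered at its left end, by `A c` if it has colour `c`
      -- and by `A′ d` if it has colour `d`. The colours are left open so that both cases of
      -- `no-witness` are instances.
      no-one-sided-witness : ∀ c d → (∀ x → x ≡ c ⊎ x ≡ d) → m ≤ suc k + (∣ B′ c ∣ + ∣ B′ d ∣) →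
        ∀ j → suc k ≤ toℕ j → j ∉ˢ B c → ¬ j ∉ˢ B′ d
      -- Substituting `k ≤ ∣ A c ∣ + ∣ A′ d ∣` gives `m ≤ 1 + ∣ A c ∣ + ∣ B′ c ∣ + (∣ A′ d ∣ + ∣ B′
      -- d ∣) ≤ 1 + 3(n - 1)`, which is below `3n - 1`.
      no-one-sided-witness c d c-or-d m≤ j k<j j∉Bc j∉B′d = ≤⇒≢suc+
        (+-mono-≤ (+-mono-≤ (small c) (+-mono-≤ (small′ c) (small′ d))) (+-mono-≤ k≤′ (+-mono-≤ m≤ 3n≤1+m)))
        (identity k m n (∣ A c ∣) (∣ B c ∣) (∣ A′ c ∣) (∣ B′ c ∣) (∣ A′ d ∣) (∣ B′ d ∣))
        where
        left-covered : Initial⊆ k (A c ∪ A′ d)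
        left-covered i i<k = x∈p∪q⁺ (by-colour (c-or-d (χ e)))
          where
          e : Edge m
          -- Since `i < k` and `k + 1 ≤ j`, this edge crosses both cuts, so `C` and `C′` both apply
          -- to it.
          e = edge i j (<-trans i<k k<j)
          by-colour : χ e ≡ c ⊎ χ e ≡ d → i ∈ˢ A c ⊎ i ∈ˢ A′ d
          by-colour (inj₁ χe≡c) with subst (λ x → i ∈ˢ A x ⊎ j ∈ˢ B x) χe≡c (covers e (i<k , <⇒≤ k<j))
          ... | inj₁ i∈ = inj₁ i∈
          ... | inj₂ j∈ = contradiction j∈ j∉Bc
          by-colour (inj₂ χe≡d) with subst (λ x → i ∈ˢ A′ x ⊎ j ∈ˢ B′ x) χe≡d (covers′ e (m<n⇒m<1+n i<k , k<j))
          ... | inj₁ i∈ = inj₂ i∈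
          ... | inj₂ j∈ = contradiction j∈ j∉B′d
        k≤′ : k ≤ ∣ A c ∣ + ∣ A′ d ∣
        k≤′ = ≤-trans (Initial⊆⇒k≤∣A∣ (A c ∪ A′ d) (<⇒≤ k<m) left-covered) (∣p∪q∣≤∣p∣+∣q∣ (A c) (A′ d))
        identity : ∀ k m n a b a′ b′ a″ b″ →
          ((1 + (a + b)) + ((1 + (a′ + b′)) + (1 + (a″ + b″)))) + (k + (m + 3 * n))
          ≡ 1 + ((n + (n + n)) + ((a + a″) + ((1 + k) + (b′ + b″) + (1 + m))) + (b + a′))
        identity = solve-∀

      no-witness : ∀ j → suc k ≤ toℕ j → ¬ j ∉ˢ ∪B ∪ ∩B′
      no-witness j k<j j∉ = by-side (x∈p∪q⁻ (B′ zero) (B′ (suc zero)) (final j k<j))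
        where
        m≤ : m ≤ suc k + (∣ B′ zero ∣ + ∣ B′ (suc zero) ∣)
        m≤ = ≤-trans (m≤m+n m ∣ ∩B′ ∣) m+∣∩B′∣≤
        j∉B₀ : j ∉ˢ B zero
        j∉B₀ j∈ = j∉ (x∈p∪q⁺ (inj₁ (x∈p∪q⁺ (inj₁ j∈))))
        j∉B₁ : j ∉ˢ B (suc zero)
        j∉B₁ j∈ = j∉ (x∈p∪q⁺ (inj₁ (x∈p∪q⁺ (inj₂ j∈))))
        j∉∩B′ : j ∈ˢ B′ zero → j ∉ˢ B′ (suc zero)
        j∉∩B′ j∈₀ j∈₁ = j∉ (x∈p∪q⁺ (inj₂ (x∈p∩q⁺ (j∈₀ , j∈₁))))
        by-side : ¬ (j ∈ˢ B′ zero ⊎ j ∈ˢ B′ (suc zero))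
        by-side (inj₁ j∈) = no-one-sided-witness zero (suc zero)
          (λ { zero → inj₁ refl ; (suc zero) → inj₂ refl })
          m≤ j k<j j∉B₀ (j∉∩B′ j∈)
        by-side (inj₂ j∈) = no-one-sided-witness (suc zero) zero
          (λ { zero → inj₂ refl ; (suc zero) → inj₁ refl })
          (subst (λ s → m ≤ suc k + s) (+-comm (∣ B′ zero ∣) (∣ B′ (suc zero) ∣)) m≤)
          j k<j j∉B₁ (λ j∈₀ → j∉∩B′ j∈₀ j∈)

      impossible : False
      impossible = ∪B∪∩B′-not-final λ j k<j → decidable-stable (j ∈? (∪B ∪ ∩B′)) (no-witness j k<j)

  -- Induction along the cuts: the left side of cut `0` is empty, and `Jump` excludes the only way
  -- in which the property could fail at the next cut.
  initial-or-matching : ∀ k → k ≤ m →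
    MonochromaticMatching ⊎ ∃[ C ] Initial⊆ k (Covers.∪A {k} C)
  initial-or-matching zero _ = Sum.map₂ (λ C → C , λ _ ()) (covers-or-matching zero)
  initial-or-matching (suc k) k<m with initial-or-matching k (<⇒≤ k<m) | covers-or-matching (suc k)
  ... | inj₁ M             | _       = inj₁ M
  ... | inj₂ _             | inj₁ M  = inj₁ M
  ... | inj₂ (C , initial) | inj₂ C′ with Covers.initial-or-final C′
  ...   | inj₁ initial′ = inj₂ (C′ , initial′)
  ...   | inj₂ final    = contradiction final (Jump.impossible k<m C C′ initial)

  monochromatic-matching : MonochromaticMatching
  monochromatic-matching with initial-or-matching m ≤-refl
  ... | inj₁ M = M
  -- At the last cut all vertices lie in `∪A`, so `m ≤ 2(n - 1)`, against `m ≥ 3n - 1`.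
  ... | inj₂ (C , initial) = contradiction
    (identity m n (∣ A zero ∣) (∣ A (suc zero) ∣) (∣ B zero ∣) (∣ B (suc zero) ∣))
    (≤⇒≢suc+ (+-mono-≤ (+-mono-≤ (small zero) (small (suc zero))) (+-mono-≤ m≤ 3n≤1+m)))
    where
    open Covers C
    m≤ : m ≤ ∣ A zero ∣ + ∣ A (suc zero) ∣
    m≤ = ≤-trans (Initial⊆⇒k≤∣A∣ ∪A ≤-refl initial) (∣p∪q∣≤∣p∣+∣q∣ (A zero) (A (suc zero)))
    identity : ∀ m n a₀ a₁ b₀ b₁ →
      ((1 + (a₀ + b₀)) + (1 + (a₁ + b₁))) + (m + 3 * n)
      ≡ 1 + ((n + n) + ((a₀ + a₁) + (1 + m)) + (b₀ + b₁ + n))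
    identity = solve-∀

theorem2p15 : (n : ℕ) → 1 ≤ n → (χ : 2-Coloring (3 * n ∸ 1)) →
    ∃[ M ] (IsMatching M × NonSeparated M × Monochromatic χ M × length M ≡ n)
theorem2p15 n _ χ = Cuts.monochromatic-matching n (m≤n+m∸n (3 * n) 1) χ
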